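{- For any $\mathcal{ELD}$-formula $\varphi$ and any set $\Phi$ of $\mathcal{ELD}$-formulas, if $\Phi\models_{\mathrm{ELD}^s}\varphi$, then $\Phi\vdash_{\mathbf{KB(D)}}\varphi$.
   Context: Fix a countably infinite set $\mathsf{Prop}$ and a finite nonempty set $\mathsf{Ag}$ of agents; groups are nonempty subsets of $\mathsf{Ag}$. $\mathcal{ELD}$-formulas: $\varphi::=p\mid\neg\varphi\mid(\varphi\to\varphi)\mid K_a\varphi\mid D_G\varphi$ ($p\in\mathsf{Prop}$, $a\in\mathsf{Ag}$, $G$ a group). A similarity model is $M=(W,A,E,C,\nu)$ with $W\neq\emptyset$, $A$ an arbitrary set, $E:W\times W\to\wp(A)$, $C:\mathsf{Ag}\to\wp(A)$, $\nu:W\to\wp(\mathsf{Prop})$, such that for all $s,t\in W$: $E(s,t)=A$ implies $s=t$, and $E(s,t)=E(t,s)$. Satisfaction: $M,s\models p$ iff $p\in\nu(s)$; Booleans as usual; $M,s\models K_a\psi$ iff $M,t\models\psi$ for all $t$ with $C(a)\subseteq E(s,t)$; $M,s\models D_G\psi$ iff $M,t\models\psi$ for all $t$ with $\bigcup_{a\in G}C(a)\subseteq E(s,t)$. $\Phi\models_{\mathrm{ELD}^s}\varphi$ means: every state of every similarity model satisfying all formulas of $\Phi$ satisfies $\varphi$. $\mathbf{KB(D)}$: axioms are all instances of propositional tautologies; $K_a(\varphi\to\psi)\to(K_a\varphi\to K_a\psi)$; $\varphi\to K_a\neg K_a\neg\varphi$; $D_G(\varphi\to\psi)\to(D_G\varphi\to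 D_G\psi)$; $D_{\{a\}}\varphi\leftrightarrow K_a\varphi$; $D_G\varphi\to D_H\varphi$ for $G\subseteq H$; $\varphi\to D_G\neg D_G\neg\varphi$. Rules: from $\varphi$ and $\varphi\to\psi$ infer $\psi$; from $\varphi$ infer $K_a\varphi$. $\Phi\vdash_{\mathbf{KB(D)}}\varphi$ means there is a finite $\Phi_0\subseteq\Phi$ such that $\bigwedge\Phi_0\to\varphi$ is a theorem of $\mathbf{KB(D)}$. -}

module Defs where

open import Data.Bool.Base using (Bool; true; not; _∨_)
open import Data.Fin.Base using (Fin)
open import Data.Fin.Subset as Subset using (Subset; Nonempty; ⁅_⁆)
open import Data.Fin.Subset.Properties using (x∈⁅x⁆)
open import Data.List.Base using (List; foldr)
open import Data.List.Relation.Unary.All using (All)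
open import Data.Nat.Base using (ℕ)
open import Data.Product.Base using (Σ; ∃-syntax; _×_; _,_; proj₁)
open import Level using (0ℓ)
open import Relation.Binary.PropositionalEquality using (_≡_)
open import Relation.Nullary.Negation using (¬_)
open import Relation.Unary using (Pred; _∈_; _⊆_; _≐_; U; ⋃)

infixr 5 _⇒_ _⇒ᵖ_ _⇔_
infixr 6 _∧_
infix  8 ~_ ~ᵖ_
infix  3 ⊢_ _⊢_ _⊨_ _,_⊩_

-- The countably infinite set of atoms is ℕ.  The set of agents is Fin n; it is
-- nonempty exactly when n is a successor.

-- The nonemptiness proof is irrelevant, so that two groups with the same
-- members are equal and D G φ depends on the members of G only.
record Group (n : ℕ) : Set where
  constructor group
  field
    members   : Subset n
    .nonempty : Nonempty members

open Group public

singleton : {n : ℕ} → Fin n → Group n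
singleton a = group ⁅ a ⁆ (a , x∈⁅x⁆ a)

data Formula (n : ℕ) : Set where
  atom : ℕ → Formula n
  ~_   : Formula n → Formula n
  _⇒_  : Formula n → Formula n → Formula n
  K    : Fin n → Formula n → Formula n
  D    : Group n → Formula n → Formula n

_∧_ : {n : ℕ} → Formula n → Formula n → Formula n
φ ∧ ψ = ~ (φ ⇒ ~ ψ)

_⇔_ : {n : ℕ} → Formula n → Formula n → Formula n
φ ⇔ ψ = (φ ⇒ ψ) ∧ (ψ ⇒ φ)

verum : {n : ℕ} → Formula n
verum = atom 0 ⇒ atom 0

-- The empty conjunction is verum.
⋀ : {n : ℕ} → List (Formula n) → Formula n
⋀ = foldr _∧_ verum

record SimilarityModel (n : ℕ) : Set₁ where
  field
    W        : Set
    nonempty : W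
    A        : Set
    E        : W → W → Pred A 0ℓ
    C        : Fin n → Pred A 0ℓ
    ν        : W → Pred ℕ 0ℓ
    E-full   : (s t : W) → E s t ≐ U → s ≡ t
    E-sym    : (s t : W) → E s t ≐ E t s

_,_⊩_ : {n : ℕ} (M : SimilarityModel n) → SimilarityModel.W M → Formula n → Set
M , s ⊩ atom p  = p ∈ SimilarityModel.ν M s
M , s ⊩ ~ φ     = ¬ (M , s ⊩ φ)
M , s ⊩ (φ ⇒ ψ) = M , s ⊩ φ → M , s ⊩ ψ
M , s ⊩ K a φ   = (t : W) → C a ⊆ E s t → M , t ⊩ φ
  where open SimilarityModel M
M , s ⊩ D G φ   =
  (t : W) → ⋃ (Σ _ (Subset._∈ members G)) (λ a → C (proj₁ a)) ⊆ E s t → M , t ⊩ φ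
  where open SimilarityModel M

_⊨_ : {n : ℕ} → Pred (Formula n) 0ℓ → Formula n → Set₁
_⊨_ {n} Φ φ = (M : SimilarityModel n) (s : SimilarityModel.W M) →
              ((ψ : Formula n) → ψ ∈ Φ → M , s ⊩ ψ) → M , s ⊩ φ

data PropFormula : Set where
  var  : ℕ → PropFormula
  ~ᵖ_  : PropFormula → PropFormula
  _⇒ᵖ_ : PropFormula → PropFormula → PropFormula

eval : (ℕ → Bool) → PropFormula → Bool
eval v (var i)  = v i
eval v (~ᵖ α)   = not (eval v α)
eval v (α ⇒ᵖ β) = not (eval v α) ∨ eval v β

Tautology : PropFormula → Set
Tautology α = (v : ℕ → Bool) → eval v α ≡ true

substitute : {n : ℕ} → (ℕ → Formula n) → PropFormula → Formula n
substitute σ (var i)  = σ i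
substitute σ (~ᵖ α)   = ~ substitute σ α
substitute σ (α ⇒ᵖ β) = substitute σ α ⇒ substitute σ β

data ⊢_ {n : ℕ} : Formula n → Set where
  taut : (α : PropFormula) → Tautology α → (σ : ℕ → Formula n) → ⊢ substitute σ α
  K-K  : (a : Fin n) (φ ψ : Formula n) → ⊢ K a (φ ⇒ ψ) ⇒ (K a φ ⇒ K a ψ)
  B-K  : (a : Fin n) (φ : Formula n) → ⊢ φ ⇒ K a (~ K a (~ φ))
  K-D  : (G : Group n) (φ ψ : Formula n) → ⊢ D G (φ ⇒ ψ) ⇒ (D G φ ⇒ D G ψ)
  D-K  : (a : Fin n) (φ : Formula n) → ⊢ D (singleton a) φ ⇔ K a φ
  D-⊆  : (G H : Group n) (φ : Formula n) → members G Subset.⊆ members H →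
         ⊢ D G φ ⇒ D H φ
  B-D  : (G : Group n) (φ : Formula n) → ⊢ φ ⇒ D G (~ D G (~ φ))
  MP   : {φ ψ : Formula n} → ⊢ φ → ⊢ φ ⇒ ψ → ⊢ ψ
  Nec  : (a : Fin n) {φ : Formula n} → ⊢ φ → ⊢ K a φ

_⊢_ : {n : ℕ} → Pred (Formula n) 0ℓ → Formula n → Set
_⊢_ {n} Φ φ = ∃[ Φ₀ ] All (_∈ Φ) Φ₀ × (⊢ ⋀ Φ₀ ⇒ φ)

{-# OPTIONS --safe #-}
-- A consistent set is extended to a maximal consistent one by Lindenbaum's
-- construction.  In the canonical model, the states are pairs of a maximal
-- consistent set and a set of agents ("colour").  The only agents that may be
-- unable to tell two states apart are those in the symmetric difference p of
-- their colours, and they are so exactly if the canonical relation of p holds.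
-- Thus all links between two states come from a single group, which
-- makes the relation of a group the intersection of those of its members; and
-- every group occurs as the difference between a given colour and another one.
-- Adding to the set A one attribute on which no two states agree makes
-- E(s,t) = A impossible.
module Submission where

open import Defs
open import Axiom.ExcludedMiddle using (ExcludedMiddle)
open import Data.Bool.Base using (Bool; true; false; T; not; _∨_; _xor_)
open import Data.Bool.Properties using (T?; xor-comm)
open import Data.Empty using (⊥; ⊥-elim)
import Data.Empty.Irrelevant as Irrelevant
open import Data.Fin.Base using (Fin)
open import Data.Fin.Subset as Subset using (Subset; Nonempty; ⁅_⁆; inside; outside)
open import Data.Fin.Subset.Properties using (nonempty?; x∈⁅x⁆; x∈⁅y⁆⇒x≡y)
open import Data.List.Base using (List; []; _∷_; _++_; map; concatMap; cartesianProductWith; allFin)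
open import Data.List.Membership.Propositional using () renaming (_∈_ to _∈ˡ_)
open import Data.List.Membership.Propositional.Properties
  using (∈-++⁺ˡ; ∈-++⁺ʳ; ∈-map⁺; ∈-cartesianProductWith⁺; ∈-allFin; ∈-concatMap⁺)
open import Data.List.Relation.Unary.All using (All; []; _∷_)
open import Data.List.Relation.Unary.All.Properties using (++⁺)
open import Data.List.Relation.Unary.Any as Any using (here; there)
open import Data.Maybe.Base using (Maybe; just; nothing)
open import Data.Nat.Base using (ℕ; zero; suc; _⊔_; _≤_; _≤′_; ≤′-refl; ≤′-step)
open import Data.Nat.Properties using (≤⇒≤′; m≤m⊔n; m≤n⊔m)
open import Data.Product.Base using (Σ; ∃-syntax; _×_; _,_; proj₁; proj₂)
open import Data.Sum.Base using (_⊎_; inj₁; inj₂)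
open import Data.Unit.Base using (tt)
open import Data.Vec.Base using ([]; _∷_; zipWith)
open import Data.Vec.Properties using (zipWith-comm)
open import Function.Base using (_∘_)
open import Level using (0ℓ)
open import Relation.Binary.PropositionalEquality using (_≡_; refl; sym; cong₂; subst)
open import Relation.Nullary.Decidable using (yes; no; recompute; ⌊_⌋; toWitness; fromWitness)
open import Relation.Nullary.Negation using (¬_)
open import Relation.Unary using (Pred; _∈_; _⊆_; _∪_; ｛_｝)

private variable
  n : ℕ
  φ ψ χ : Formula n
  S T′ : Pred (Formula n) 0ℓ

-- Propositional reasoning

instantiate : Formula n → Formula n → Formula n → ℕ → Formula n
instantiate φ ψ χ 0             = φ
instantiate φ ψ χ 1             = ψ
instantiate φ ψ χ (suc (suc _)) = χ

p₀ p₁ p₂ : PropFormula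
p₀ = var 0
p₁ = var 1
p₂ = var 2

⇒-const : (φ ψ : Formula n) → ⊢ φ ⇒ ψ ⇒ φ
⇒-const φ ψ = taut (p₀ ⇒ᵖ p₁ ⇒ᵖ p₀) (λ v → valid (v 0) (v 1)) (instantiate φ ψ ψ)
  where
  valid : ∀ a b → not a ∨ (not b ∨ a) ≡ true
  valid false _     = refl
  valid true  false = refl
  valid true  true  = refl

⇒-distrib : (φ ψ χ : Formula n) → ⊢ (φ ⇒ ψ ⇒ χ) ⇒ (φ ⇒ ψ) ⇒ φ ⇒ χ
⇒-distrib φ ψ χ =
  taut ((p₀ ⇒ᵖ p₁ ⇒ᵖ p₂) ⇒ᵖ (p₀ ⇒ᵖ p₁) ⇒ᵖ p₀ ⇒ᵖ p₂)
       (λ v → valid (v 0) (v 1) (v 2)) (instantiate φ ψ χ)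
  where
  valid : ∀ a b c → not (not a ∨ (not b ∨ c)) ∨ (not (not a ∨ b) ∨ (not a ∨ c)) ≡ true
  valid false _     _     = refl
  valid true  false _     = refl
  valid true  true  false = refl
  valid true  true  true  = refl

⇒-refl : (φ : Formula n) → ⊢ φ ⇒ φ
⇒-refl φ = taut (p₀ ⇒ᵖ p₀) (λ v → valid (v 0)) (instantiate φ φ φ)
  where
  valid : ∀ a → not a ∨ a ≡ true
  valid false = refl
  valid true  = refl

falsum : Formula n
falsum = ~ verum

~-intro : (φ : Formula n) → ⊢ (φ ⇒ falsum) ⇒ ~ φ
-- Taking `atom 0` for `p₁` turns `~ᵖ (p₁ ⇒ᵖ p₁)` into `falsum`.
~-intro φ = taut ((p₀ ⇒ᵖ ~ᵖ (p₁ ⇒ᵖ p₁)) ⇒ᵖ ~ᵖ p₀)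
                 (λ v → valid (v 0) (v 1)) (instantiate φ (atom 0) φ)
  where
  valid : ∀ a b → not (not a ∨ not (not b ∨ b)) ∨ not a ≡ true
  valid false _     = refl
  valid true  false = refl
  valid true  true  = refl

by-contradiction : (φ : Formula n) → ⊢ (~ φ ⇒ falsum) ⇒ φ
by-contradiction φ = taut ((~ᵖ p₀ ⇒ᵖ ~ᵖ (p₁ ⇒ᵖ p₁)) ⇒ᵖ p₀)
                          (λ v → valid (v 0) (v 1)) (instantiate φ (atom 0) φ)
  where
  valid : ∀ a b → not (not (not a) ∨ not (not b ∨ b)) ∨ a ≡ true
  valid true  _     = refl
  valid false false = refl
  valid false true  = refl

explosion : (φ ψ : Formula n) → ⊢ ~ φ ⇒ φ ⇒ ψ
explosion φ ψ = taut (~ᵖ p₀ ⇒ᵖ p₀ ⇒ᵖ p₁) (λ v → valid (v 0) (v 1)) (instantiate φ ψ ψ)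
  where
  valid : ∀ a b → not (not a) ∨ (not a ∨ b) ≡ true
  valid false _ = refl
  valid true  _ = refl

~~-intro : (φ : Formula n) → ⊢ φ ⇒ ~ ~ φ
~~-intro φ = taut (p₀ ⇒ᵖ ~ᵖ ~ᵖ p₀) (λ v → valid (v 0)) (instantiate φ φ φ)
  where
  valid : ∀ a → not a ∨ not (not a) ≡ true
  valid false = refl
  valid true  = refl

∧-elimˡ : (φ ψ : Formula n) → ⊢ φ ∧ ψ ⇒ φ
∧-elimˡ φ ψ = taut (~ᵖ (p₀ ⇒ᵖ ~ᵖ p₁) ⇒ᵖ p₀) (λ v → valid (v 0) (v 1)) (instantiate φ ψ ψ)
  where
  valid : ∀ a b → not (not (not a ∨ not b)) ∨ a ≡ true
  valid false _     = refl
  valid true  false = refl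
  valid true  true  = refl

∧-elimʳ : (φ ψ : Formula n) → ⊢ φ ∧ ψ ⇒ ψ
∧-elimʳ φ ψ = taut (~ᵖ (p₀ ⇒ᵖ ~ᵖ p₁) ⇒ᵖ p₁) (λ v → valid (v 0) (v 1)) (instantiate φ ψ ψ)
  where
  valid : ∀ a b → not (not (not a ∨ not b)) ∨ b ≡ true
  valid false _     = refl
  valid true  false = refl
  valid true  true  = refl

⇒-trans : ⊢ φ ⇒ ψ → ⊢ ψ ⇒ χ → ⊢ φ ⇒ χ
⇒-trans {φ = φ} {ψ = ψ} {χ = χ} p q =
  MP p (MP (MP q (⇒-const (ψ ⇒ χ) φ)) (⇒-distrib φ ψ χ))

-- Derivations from hypotheses

infix 3 _⊢ʰ_

-- Necessitation is available for theorems only, so that the deduction theorem holds.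
data _⊢ʰ_ (S : Pred (Formula n) 0ℓ) : Formula n → Set where
  hyp : φ ∈ S → S ⊢ʰ φ
  thm : ⊢ φ → S ⊢ʰ φ
  mp  : S ⊢ʰ φ → S ⊢ʰ φ ⇒ ψ → S ⊢ʰ ψ

weaken : S ⊆ T′ → S ⊢ʰ φ → T′ ⊢ʰ φ
weaken i (hyp x)  = hyp (i x)
weaken i (thm t)  = thm t
weaken i (mp d e) = mp (weaken i d) (weaken i e)

deduction : S ∪ ｛ φ ｝ ⊢ʰ ψ → S ⊢ʰ φ ⇒ ψ
deduction {φ = φ} {ψ = ψ} (hyp (inj₁ x)) = mp (hyp x) (thm (⇒-const ψ φ))
deduction {φ = φ} (hyp (inj₂ refl))      = thm (⇒-refl φ)
deduction {φ = φ} {ψ = ψ} (thm t)        = thm (MP t (⇒-const ψ φ))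
deduction {φ = φ} {ψ = ψ} (mp {φ = χ} d e) =
  mp (deduction d) (mp (deduction e) (thm (⇒-distrib φ χ ψ)))

∈⇒⊢⋀ : {xs : List (Formula n)} → φ ∈ˡ xs → ⊢ ⋀ xs ⇒ φ
∈⇒⊢⋀ {xs = x ∷ xs} (here refl) = ∧-elimˡ x (⋀ xs)
∈⇒⊢⋀ {xs = x ∷ xs} (there i)   = ⇒-trans (∧-elimʳ x (⋀ xs)) (∈⇒⊢⋀ i)

⊢ʰ⇒⊢⋀ : {xs : List (Formula n)} → (_∈ˡ xs) ⊢ʰ φ → ⊢ ⋀ xs ⇒ φ
⊢ʰ⇒⊢⋀ (hyp i) = ∈⇒⊢⋀ i
⊢ʰ⇒⊢⋀ {φ = φ} {xs = xs} (thm t) = MP t (⇒-const φ (⋀ xs))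
⊢ʰ⇒⊢⋀ {φ = φ} {xs = xs} (mp {φ = ψ} d e) =
  MP (⊢ʰ⇒⊢⋀ d) (MP (⊢ʰ⇒⊢⋀ e) (⇒-distrib (⋀ xs) ψ φ))

finitary : S ⊢ʰ φ → ∃[ xs ] All (_∈ S) xs × ((_∈ˡ xs) ⊢ʰ φ)
finitary (hyp {φ = φ} x) = φ ∷ [] , x ∷ [] , hyp (here refl)
finitary (thm t)         = [] , [] , thm t
finitary (mp d e) with finitary d | finitary e
... | xs , as , d′ | ys , bs , e′ =
  xs ++ ys , ++⁺ as bs , mp (weaken ∈-++⁺ˡ d′) (weaken (∈-++⁺ʳ xs) e′)

⊢ʰ⇒⊢ : S ⊢ʰ φ → S ⊢ φ
⊢ʰ⇒⊢ d with finitary d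
... | xs , as , d′ = xs , as , ⊢ʰ⇒⊢⋀ d′

Consistent : Pred (Formula n) 0ℓ → Set
Consistent S = ¬ (S ⊢ʰ falsum)

refute : S ∪ ｛ φ ｝ ⊢ʰ falsum → S ⊢ʰ ~ φ
refute {φ = φ} d = mp (deduction d) (thm (~-intro φ))

refute-~ : S ∪ ｛ ~ φ ｝ ⊢ʰ falsum → S ⊢ʰ φ
refute-~ {φ = φ} d = mp (deduction d) (thm (by-contradiction φ))

contradictory : S ⊢ʰ φ → S ⊢ʰ ~ φ → S ⊢ʰ falsum
contradictory {φ = φ} d e = mp d (mp e (thm (explosion φ falsum)))

-- Enumeration of the formulas

subsets : (n : ℕ) → List (Subset n)
subsets zero    = [] ∷ []
subsets (suc n) = map (inside ∷_) (subsets n) ++ map (outside ∷_) (subsets n)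

∈-subsets : (p : Subset n) → p ∈ˡ subsets n
∈-subsets []            = here refl
∈-subsets (inside ∷ p)  = ∈-++⁺ˡ (∈-map⁺ (inside ∷_) (∈-subsets p))
∈-subsets (outside ∷ p) = ∈-++⁺ʳ (map (inside ∷_) (subsets _)) (∈-map⁺ (outside ∷_) (∈-subsets p))

groupsOn : Subset n → List (Group n)
groupsOn p with nonempty? p
... | yes ne = group p ne ∷ []
... | no _   = []

∈-groupsOn : (G : Group n) → G ∈ˡ groupsOn (members G)
∈-groupsOn (group p ne) with nonempty? p
-- The proof found here may differ from the given one, but irrelevance makes the two groups equal.
... | yes _  = here refl
... | no ¬ne = Irrelevant.⊥-elim (¬ne ne)

groups : (n : ℕ) → List (Group n)
groups n = concatMap groupsOn (subsets n)

∈-groups : (G : Group n) → G ∈ˡ groups n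
∈-groups G = ∈-concatMap⁺ groupsOn
  (Any.map (λ { refl → ∈-groupsOn G }) (∈-subsets (members G)))

compounds : List (Formula n) → List (Formula n)
compounds {n} l =
  map ~_ l ++ cartesianProductWith _⇒_ l l ++
  cartesianProductWith K (allFin n) l ++ cartesianProductWith D (groups n) l

-- Each level is finite, so Lindenbaum's construction can treat it in one stage. Keeping the earlier
-- levels brings both sides of an implication together at the maximum of their levels.
level : ℕ → List (Formula n)
level zero    = []
level (suc k) = atom k ∷ level k ++ compounds (level k)

level-mono′ : {j k : ℕ} → j ≤′ k → φ ∈ˡ level j → φ ∈ˡ level k
level-mono′ ≤′-refl     i = i
level-mono′ (≤′-step q) i = there (∈-++⁺ˡ (level-mono′ q i))

level-mono : {j k : ℕ} → j ≤ k → φ ∈ˡ level j → φ ∈ˡ level k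
level-mono q = level-mono′ (≤⇒≤′ q)

compound∈level : {k : ℕ} → φ ∈ˡ compounds (level k) → φ ∈ˡ level (suc k)
compound∈level {k = k} i = there (∈-++⁺ʳ (level k) i)

∈-level : (φ : Formula n) → ∃[ k ] φ ∈ˡ level k
∈-level (atom p) = suc p , here refl
∈-level (~ φ) with ∈-level φ
... | k , i = suc k , compound∈level (∈-++⁺ˡ (∈-map⁺ ~_ i))
∈-level (φ ⇒ ψ) with ∈-level φ | ∈-level ψ
... | j , i | k , i′ = suc (j ⊔ k) , compound∈level
  (∈-++⁺ʳ (map ~_ (level (j ⊔ k)))
    (∈-++⁺ˡ (∈-cartesianProductWith⁺ _⇒_ (level-mono (m≤m⊔n j k) i) (level-mono (m≤n⊔m j k) i′))))
∈-level (K a φ) with ∈-level φ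
... | k , i = suc k , compound∈level
  (∈-++⁺ʳ (map ~_ (level k)) (∈-++⁺ʳ (cartesianProductWith _⇒_ (level k) (level k))
    (∈-++⁺ˡ (∈-cartesianProductWith⁺ K (∈-allFin a) i))))
∈-level (D G φ) with ∈-level φ
... | k , i = suc k , compound∈level
  (∈-++⁺ʳ (map ~_ (level k)) (∈-++⁺ʳ (cartesianProductWith _⇒_ (level k) (level k))
    (∈-++⁺ʳ (cartesianProductWith K (allFin _) (level k))
      (∈-cartesianProductWith⁺ D (∈-groups G) i))))

-- Maximal consistent sets

-- Membership is Bool-valued so that the maximal consistent sets form a Set and
-- can be states of a similarity model.
record MCS (n : ℕ) : Set where
  field
    has    : Formula n → Bool
    closed : {φ : Formula n} → (T ∘ has) ⊢ʰ φ → T (has φ)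
    ~⇒∉    : {φ : Formula n} → T (has (~ φ)) → ¬ T (has φ)
    ∉⇒~    : {φ : Formula n} → ¬ T (has φ) → T (has (~ φ))

open MCS

infix 4 _∋_

_∋_ : MCS n → Formula n → Set
Γ ∋ φ = T (has Γ φ)

∋-mp : (Γ : MCS n) → ⊢ φ ⇒ ψ → Γ ∋ φ → Γ ∋ ψ
∋-mp Γ t x = closed Γ (mp (hyp x) (thm t))

-- Lindenbaum's lemma

module Lindenbaum (em : ExcludedMiddle 0ℓ) where

  -- Consistency is made a condition on membership, so that the set is defined without a case
  -- distinction; excluded middle enters only in proofs about it.
  extend : Pred (Formula n) 0ℓ → Formula n → Pred (Formula n) 0ℓ
  extend S φ ψ = ψ ∈ S ⊎ φ ≡ ψ × Consistent (S ∪ ｛ φ ｝)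

  extend-consistent : (φ : Formula n) → Consistent S → Consistent (extend S φ)
  extend-consistent {S = S} φ con d with em {Consistent (S ∪ ｛ φ ｝)}
  ... | yes con′ = con′ (weaken (λ { (inj₁ x) → inj₁ x ; (inj₂ (e , _)) → inj₂ e }) d)
  ... | no ¬con  = con (weaken (λ { (inj₁ x) → x ; (inj₂ (_ , c)) → ⊥-elim (¬con c) }) d)

  extend-decides : (φ : Formula n) → φ ∈ extend S φ ⊎ (extend S φ ⊢ʰ ~ φ)
  extend-decides {S = S} φ with em {S ∪ ｛ φ ｝ ⊢ʰ falsum}
  ... | yes d  = inj₂ (weaken inj₁ (refute d))
  ... | no con = inj₁ (inj₂ (refl , con))

  extendAll : Pred (Formula n) 0ℓ → List (Formula n) → Pred (Formula n) 0ℓ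
  extendAll S []       = S
  extendAll S (φ ∷ φs) = extendAll (extend S φ) φs

  extendAll-⊇ : (φs : List (Formula n)) → S ⊆ extendAll S φs
  extendAll-⊇ []       x = x
  extendAll-⊇ (φ ∷ φs) x = extendAll-⊇ φs (inj₁ x)

  extendAll-consistent : (φs : List (Formula n)) → Consistent S → Consistent (extendAll S φs)
  extendAll-consistent []       con = con
  extendAll-consistent (φ ∷ φs) con = extendAll-consistent φs (extend-consistent φ con)

  extendAll-decides : {φs : List (Formula n)} → φ ∈ˡ φs →
                      φ ∈ extendAll S φs ⊎ (extendAll S φs ⊢ʰ ~ φ)
  extendAll-decides {S = S} {φs = φ ∷ φs} (here refl) with extend-decides {S = S} φ
  ... | inj₁ x = inj₁ (extendAll-⊇ φs x)
  ... | inj₂ d = inj₂ (weaken (extendAll-⊇ φs) d)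
  extendAll-decides (there i) = extendAll-decides i

  stage : Pred (Formula n) 0ℓ → ℕ → Pred (Formula n) 0ℓ
  stage S zero    = S
  stage S (suc k) = extendAll (stage S k) (level k)

  stage-mono′ : {j k : ℕ} → j ≤′ k → stage S j ⊆ stage S k
  stage-mono′ ≤′-refl             x = x
  stage-mono′ (≤′-step {n = k} q) x = extendAll-⊇ (level k) (stage-mono′ q x)

  stage-mono : {j k : ℕ} → j ≤ k → stage S j ⊆ stage S k
  stage-mono q = stage-mono′ (≤⇒≤′ q)

  stage-consistent : Consistent S → (k : ℕ) → Consistent (stage S k)
  stage-consistent con zero    = con
  stage-consistent con (suc k) = extendAll-consistent (level k) (stage-consistent con k)

  limit : Pred (Formula n) 0ℓ → Pred (Formula n) 0ℓ
  limit S φ = ∃[ k ] φ ∈ stage S k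

  limit-compact : limit S ⊢ʰ φ → ∃[ k ] (stage S k ⊢ʰ φ)
  limit-compact (hyp (k , x)) = k , hyp x
  limit-compact (thm t)       = 0 , thm t
  limit-compact (mp d e) with limit-compact d | limit-compact e
  ... | j , d′ | k , e′ =
    j ⊔ k , mp (weaken (stage-mono (m≤m⊔n j k)) d′) (weaken (stage-mono (m≤n⊔m j k)) e′)

  limit-consistent : Consistent S → Consistent (limit S)
  limit-consistent con d with limit-compact d
  ... | k , d′ = stage-consistent con k d′

  -- If `φ` is on level `k`, stage `suc k` either admits it or already refutes it.
  limit-decides : (φ : Formula n) → φ ∈ limit S ⊎ (limit S ⊢ʰ ~ φ)
  limit-decides {S = S} φ with ∈-level φ
  ... | k , i with extendAll-decides {S = stage S k} i
  ...   | inj₁ x = inj₁ (suc k , x)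
  ...   | inj₂ d = inj₂ (weaken (suc k ,_) d)

  limit-closed : Consistent S → limit S ⊢ʰ φ → φ ∈ limit S
  limit-closed {φ = φ} con d with limit-decides φ
  ... | inj₁ x = x
  ... | inj₂ e = ⊥-elim (limit-consistent con (contradictory d e))

  lindenbaum : (S : Pred (Formula n) 0ℓ) → Consistent S →
               Σ (MCS n) λ Γ → ∀ {φ} → φ ∈ S → Γ ∋ φ
  lindenbaum {n} S con = Γ , λ x → into (0 , x)
    where
    member : Formula n → Bool
    member φ = ⌊ em {φ ∈ limit S} ⌋

    into : limit S ⊆ T ∘ member
    into = fromWitness

    out : T ∘ member ⊆ limit S
    out = toWitness

    Γ : MCS n
    Γ .has = member
    Γ .closed d = into (limit-closed con (weaken out d))
    Γ .~⇒∉ x y = limit-consistent con (contradictory (hyp (out y)) (hyp (out x)))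
    Γ .∉⇒~ {φ} x with limit-decides φ
    ... | inj₁ y = ⊥-elim (x (into y))
    ... | inj₂ d = into (limit-closed con d)

-- The canonical model

-- The stored proof is irrelevant and cannot be projected out, but nonemptiness is decidable, so a
-- member can be recomputed.
some-member : (G : Group n) → Nonempty (members G)
some-member (group p ne) = recompute (nonempty? p) ne

-- The calculus necessitates with `K` only; `D-K` passes to the singleton of a member of `G`, and
-- `D-⊆` from there to `G`.
Nec-D : (G : Group n) → ⊢ φ → ⊢ D G φ
Nec-D {φ = φ} G t with some-member G
... | a , a∈G = MP (MP (Nec a t) (MP (D-K a φ) (∧-elimʳ _ _))) (D-⊆ (singleton a) G φ ⁅a⁆⊆G)
  where
  ⁅a⁆⊆G : ⁅ a ⁆ Subset.⊆ members G
  ⁅a⁆⊆G x = subst (Subset._∈ members G) (sym (x∈⁅y⁆⇒x≡y a x)) a∈G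

-- For nonempty `p` this amounts, by `D-⊆`, to the condition for the group `p` alone. Quantifying
-- over the groups inside `p` also makes sense of the empty `p`, for which the relation is total.
R : Subset n → MCS n → MCS n → Set
R {n} p Γ Δ = (G : Group n) (φ : Formula n) → members G Subset.⊆ p → Γ ∋ D G φ → Δ ∋ φ

D-mono : (Γ : MCS n) (G : Group n) → ⊢ φ ⇒ ψ → Γ ∋ D G φ → Γ ∋ D G ψ
D-mono {φ = φ} {ψ = ψ} Γ G t = ∋-mp Γ (MP (Nec-D G t) (K-D G φ ψ))

-- If `φ` were missing from `Γ`, `B-D` would put `D G (~ D G (~ ~ φ))` into `Γ` and so
-- `~ D G (~ ~ φ)` into `Δ`, against `D G φ` in `Δ`.
R-sym : (p : Subset n) (Γ Δ : MCS n) → R p Γ Δ → R p Δ Γ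
R-sym p Γ Δ r G φ G⊆p x with T? (has Γ φ)
... | yes y = y
... | no ¬y = ⊥-elim (~⇒∉ Δ (r G _ G⊆p (∋-mp Γ (B-D G (~ φ)) (∉⇒~ Γ ¬y)))
                            (D-mono Δ G (~~-intro φ) x))

-- The derivation is replayed under `D G`: theorems are necessitated, and `K-D` takes care of modus
-- ponens.
D-closed : (Γ : MCS n) (G : Group n) → (λ ψ → Γ ∋ D G ψ) ⊢ʰ φ → Γ ∋ D G φ
D-closed Γ G (hyp x) = x
D-closed Γ G (thm t) = closed Γ (thm (Nec-D G t))
D-closed Γ G (mp d e) =
  closed Γ (mp (hyp (D-closed Γ G d)) (mp (hyp (D-closed Γ G e)) (thm (K-D G _ _))))

infixl 6 _△_

_△_ : Subset n → Subset n → Subset n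
_△_ = zipWith _xor_

△-comm : (x y : Subset n) → x △ y ≡ y △ x
△-comm = zipWith-comm xor-comm

-- This yields, for a state of colour `x`, a successor colour that differs from `x` in a prescribed
-- set of agents.
△-cancelˡ : (x y : Subset n) → x △ (x △ y) ≡ y
△-cancelˡ []      []      = refl
△-cancelˡ (a ∷ x) (b ∷ y) = cong₂ _∷_ (xor-cancelˡ a b) (△-cancelˡ x y)
  where
  xor-cancelˡ : ∀ a b → a xor (a xor b) ≡ b
  xor-cancelˡ false _     = refl
  xor-cancelˡ true  false = refl
  xor-cancelˡ true  true  = refl

State : ℕ → Set
State n = MCS n × Subset n

Link : State n → State n → Pred (Maybe (Fin n)) 0ℓ
Link (Γ , x) (Δ , y) nothing  = ⊥
Link (Γ , x) (Δ , y) (just a) = a Subset.∈ x △ y × R (x △ y) Γ Δ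

Link-sym : (s t : State n) → Link s t ⊆ Link t s
Link-sym (Γ , x) (Δ , y) {just a} (i , r) rewrite △-comm x y = i , R-sym (y △ x) Γ Δ r

canonical : MCS n → SimilarityModel n
canonical {n} Γ = record
  { W        = State n
  ; nonempty = Γ , Subset.⊥
  ; A        = Maybe (Fin n)
  ; E        = Link
  ; C        = λ a → ｛ just a ｝
  ; ν        = λ s p → proj₁ s ∋ atom p
  ; E-full   = λ s t e → ⊥-elim (proj₂ e {nothing} tt)
  ; E-sym    = λ s t → Link-sym s t , Link-sym t s
  }

Linked : Group n → State n → State n → Set
Linked G s t = ∀ a → a Subset.∈ members G → Link s t (just a)

-- The links of all members together put `G` inside the difference of the colours; the relation
-- carried by any single link then applies to `G`.
D-elim : (G : Group n) (s t : State n) → Linked G s t → proj₁ s ∋ D G φ → proj₁ t ∋ φ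
D-elim {φ = φ} G s t l x with some-member G
... | a , a∈G = proj₂ (l a a∈G) G φ (λ {b} b∈G → proj₁ (l b b∈G)) x

-- Truth lemma and completeness

module Truth (em : ExcludedMiddle 0ℓ) (Γ₀ : MCS n) where
  open Lindenbaum em

  -- If `~ φ` is consistent with all `ψ` such that `D G ψ` is in `Γ`, a maximal consistent
  -- extension, coloured `x △ members G`, is a linked state without `φ`. Otherwise these `ψ` derive
  -- `φ`, and `D-closed` applies.
  D-intro : (G : Group n) (s : State n) →
            ((t : State n) → Linked G s t → proj₁ t ∋ φ) → proj₁ s ∋ D G φ
  D-intro {φ = φ} G (Γ , x) h with em {(λ ψ → Γ ∋ D G ψ) ∪ ｛ ~ φ ｝ ⊢ʰ falsum}
  ... | yes d  = D-closed Γ G (refute-~ d)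
  ... | no con with lindenbaum _ con
  ...   | Δ , Δ⊇ = ⊥-elim (~⇒∉ Δ (Δ⊇ (inj₂ refl)) (h (Δ , x △ members G) linked))
    where
    r : R (members G) Γ Δ
    r H ψ H⊆G y = Δ⊇ (inj₁ (∋-mp Γ (D-⊆ H G ψ H⊆G) y))

    linked : Linked G (Γ , x) (Δ , x △ members G)
    -- The rewrite turns the difference of the two colours into `members G`.
    linked a a∈G rewrite △-cancelˡ x (members G) = a∈G , r

  M : SimilarityModel n
  M = canonical Γ₀

  -- The two directions need a simultaneous induction, since negations and premises of implications
  -- swap them.
  sound : (φ : Formula n) (s : State n) → M , s ⊩ φ → proj₁ s ∋ φ
  complete : (φ : Formula n) (s : State n) → proj₁ s ∋ φ → M , s ⊩ φ

  sound (atom p) s h = h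
  sound (~ φ) s h = ∉⇒~ (proj₁ s) (λ x → h (complete φ s x))
  sound (φ ⇒ ψ) s h with T? (has (proj₁ s) φ)
  ... | yes x = ∋-mp (proj₁ s) (⇒-const ψ φ) (sound ψ s (h (complete φ s x)))
  ... | no ¬x = ∋-mp (proj₁ s) (explosion φ ψ) (∉⇒~ (proj₁ s) ¬x)
  -- `K a` is treated as `D` of a singleton; `just a` is the only attribute in `C a`.
  sound (K a φ) s h = ∋-mp (proj₁ s) (MP (D-K a φ) (∧-elimˡ _ _))
    (D-intro (singleton a) s λ t l → sound φ t (h t λ { refl → l a (x∈⁅x⁆ a) }))
  sound (D G φ) s h =
    D-intro G s λ t l → sound φ t (h t λ { ((a , a∈G) , refl) → l a a∈G })

  complete (atom p) s x = x
  complete (~ φ) s x h = ~⇒∉ (proj₁ s) x (sound φ s h)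
  complete (φ ⇒ ψ) s x h =
    complete ψ s (closed (proj₁ s) (mp (hyp (sound φ s h)) (hyp x)))
  complete (K a φ) s x t l = complete φ t
    (D-elim (singleton a) s t (λ b i → subst (Link s t ∘ just) (sym (x∈⁅y⁆⇒x≡y a i)) (l refl))
      (∋-mp (proj₁ s) (MP (D-K a φ) (∧-elimʳ _ _)) x))
  complete (D G φ) s x t l =
    complete φ t (D-elim G s t (λ a a∈G → l ((a , a∈G) , refl)) x)

theorem38 : ExcludedMiddle 0ℓ →
    (n : ℕ) (φ : Formula (suc n)) (Φ : Pred (Formula (suc n)) 0ℓ) →
    Φ ⊨ φ → Φ ⊢ φ
theorem38 em n φ Φ Φ⊨φ with em {Φ ∪ ｛ ~ φ ｝ ⊢ʰ falsum}
... | yes d  = ⊢ʰ⇒⊢ (refute-~ d)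
... | no con with Lindenbaum.lindenbaum em _ con
-- All of `Φ` holds at `s`, hence so does `φ`, which then lies in `Γ` together with `~ φ`.
...   | Γ , Γ⊇ = ⊥-elim (~⇒∉ Γ (Γ⊇ (inj₂ refl))
  (sound φ s (Φ⊨φ M s λ ψ ψ∈Φ → complete ψ s (Γ⊇ (inj₁ ψ∈Φ)))))
  where
  open Truth em Γ

  s : State (suc n)
  -- Any colour would do.
  s = Γ , Subset.⊥
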